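{- Let $n\ge 8$. The maximum number of vertices of degree $n-4$ in an almost peripheral graph of order $n$ with maximum degree $n-4$ is $n-5$. This maximum is attained uniquely (up to isomorphism) by the following graph: let $H$ be the graph of order $7$ obtained from $K_4$ on vertices $h,a,b,c$ by subdividing each of the edges $ab$, $bc$, $ca$ exactly once; then replace the vertex $a$ by a complete graph $K_{n-6}$, joining every vertex of this $K_{n-6}$ to every neighbor of $a$ in $H$.
   Context: All graphs are finite and simple. For a connected graph $G$, the eccentricity of a vertex $v$ is $\max_{u\in V(G)} d(v,u)$; the diameter is the maximum eccentricity. A peripheral vertex is one whose eccentricity equals the diameter. A connected graph of order $n$ is almost peripheral if it has exactly $n-1$ peripheral vertices. Subdividing an edge $xy$ once means replacing it by a path $x,s,y$ through a new vertex $s$. -}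

module Defs where

open import Data.Nat using (ℕ; zero; suc; _≤_; _∸_)
open import Data.Fin using (Fin; toℕ; _≟_)
open import Data.Fin.Subset using (Subset; _∈_; ∣_∣)
open import Data.Vec using (tabulate)
open import Data.Bool using (Bool; true; false; if_then_else_)
open import Data.Product using (Σ; ∃; _×_; _,_)
open import Data.Sum using (_⊎_)
open import Function.Bundles using (_⇔_; _↔_; Inverse)
open import Relation.Nullary using (yes; no; ¬_)
open import Relation.Binary.PropositionalEquality using (_≡_; refl; sym)

record Graph (n : ℕ) : Set where
  field
    adj     : Fin n → Fin n → Bool
    adj-sym : ∀ u v → adj u v ≡ adj v u
    irrefl  : ∀ v → adj v v ≡ false
open Graph public

module _ {n : ℕ} (G : Graph n) where

  N : Fin n → Subset n
  N v = tabulate (adj G v)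

  degree : Fin n → ℕ
  degree v = ∣ N v ∣

  Reach : ℕ → Fin n → Fin n → Set
  Reach zero    u v = u ≡ v
  Reach (suc k) u v = Reach k u v ⊎ Σ (Fin n) λ w → Reach k u w × adj G w v ≡ true

  Connected : Set
  Connected = ∀ u v → ∃ λ k → Reach k u v

  IsDist : Fin n → Fin n → ℕ → Set
  IsDist u v k = Reach k u v × (∀ j → Reach j u v → k ≤ j)

  IsEcc : Fin n → ℕ → Set
  IsEcc v e = (∀ u k → IsDist v u k → k ≤ e) × (Σ (Fin n) λ u → IsDist v u e)

  IsDiam : ℕ → Set
  IsDiam D = (∀ v e → IsEcc v e → e ≤ D) × (Σ (Fin n) λ v → IsEcc v D)

  Peripheral : Fin n → Set
  Peripheral v = Σ ℕ λ D → IsDiam D × IsEcc v D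

NumWith : {n : ℕ} → (Fin n → Set) → ℕ → Set
NumWith {n} P k = Σ (Subset n) λ S → ∣ S ∣ ≡ k × (∀ v → (v ∈ S) ⇔ P v)

AlmostPeripheral : {n : ℕ} → Graph n → Set
AlmostPeripheral {n} G = Connected G × NumWith (Peripheral G) (n ∸ 1)

MaxDegree : {n : ℕ} → Graph n → ℕ → Set
MaxDegree {n} G Δ = (∀ v → degree G v ≤ Δ) × (Σ (Fin n) λ v → degree G v ≡ Δ)

_≅_ : {n m : ℕ} → Graph n → Graph m → Set
_≅_ {n} {m} G H = Σ (Fin n ↔ Fin m) λ f →
  ∀ u v → adj G u v ≡ adj H (Inverse.to f u) (Inverse.to f v)

-- The extremal graph.
-- H: K4 on h,a,b,c with ab, bc, ca each subdivided once (by sab, sbc, sca).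
-- Then a is replaced by a clique K_{n-6} (kind A) joined to N_H(a) = {h, sab, sca}.
-- Vertices 0..5 of Fin n are h, b, c, sab, sbc, sca; all others are clique vertices.

data Kind : Set where
  kh kb kc kab kbc kca kA : Kind

kind : {n : ℕ} → Fin n → Kind
kind v with toℕ v
... | 0 = kh
... | 1 = kb
... | 2 = kc
... | 3 = kab
... | 4 = kbc
... | 5 = kca
... | _ = kA

adjK : Kind → Kind → Bool
adjK kh  kb  = true
adjK kh  kc  = true
adjK kh  kA  = true
adjK kb  kh  = true
adjK kc  kh  = true
adjK kA  kh  = true
adjK kA  kab = true
adjK kab kA  = true
adjK kab kb  = true
adjK kb  kab = true
adjK kb  kbc = true
adjK kbc kb  = true
adjK kbc kc  = true
adjK kc  kbc = true
adjK kc  kca = true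
adjK kca kc  = true
adjK kca kA  = true
adjK kA  kca = true
adjK kA  kA  = true
adjK _   _   = false

adjK-sym : ∀ x y → adjK x y ≡ adjK y x
adjK-sym kh kh = refl
adjK-sym kh kb = refl
adjK-sym kh kc = refl
adjK-sym kh kab = refl
adjK-sym kh kbc = refl
adjK-sym kh kca = refl
adjK-sym kh kA = refl
adjK-sym kb kh = refl
adjK-sym kb kb = refl
adjK-sym kb kc = refl
adjK-sym kb kab = refl
adjK-sym kb kbc = refl
adjK-sym kb kca = refl
adjK-sym kb kA = refl
adjK-sym kc kh = refl
adjK-sym kc kb = refl
adjK-sym kc kc = refl
adjK-sym kc kab = refl
adjK-sym kc kbc = refl
adjK-sym kc kca = refl
adjK-sym kc kA = refl
adjK-sym kab kh = refl
adjK-sym kab kb = refl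
adjK-sym kab kc = refl
adjK-sym kab kab = refl
adjK-sym kab kbc = refl
adjK-sym kab kca = refl
adjK-sym kab kA = refl
adjK-sym kbc kh = refl
adjK-sym kbc kb = refl
adjK-sym kbc kc = refl
adjK-sym kbc kab = refl
adjK-sym kbc kbc = refl
adjK-sym kbc kca = refl
adjK-sym kbc kA = refl
adjK-sym kca kh = refl
adjK-sym kca kb = refl
adjK-sym kca kc = refl
adjK-sym kca kab = refl
adjK-sym kca kbc = refl
adjK-sym kca kca = refl
adjK-sym kca kA = refl
adjK-sym kA kh = refl
adjK-sym kA kb = refl
adjK-sym kA kc = refl
adjK-sym kA kab = refl
adjK-sym kA kbc = refl
adjK-sym kA kca = refl
adjK-sym kA kA = refl

extAdj : {n : ℕ} → Fin n → Fin n → Bool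
extAdj u v with u ≟ v
... | yes _ = false
... | no  _ = adjK (kind u) (kind v)

extAdj-sym : {n : ℕ} (u v : Fin n) → extAdj u v ≡ extAdj v u
extAdj-sym u v with u ≟ v | v ≟ u
... | yes _  | yes _  = refl
... | yes p  | no ¬q  with ¬q (sym p)
...   | ()
extAdj-sym u v | no ¬p | yes q with ¬p (sym q)
...   | ()
extAdj-sym u v | no _  | no _ = adjK-sym (kind u) (kind v)

extAdj-irrefl : {n : ℕ} (v : Fin n) → extAdj v v ≡ false
extAdj-irrefl v with v ≟ v
... | yes _ = refl
... | no ¬p with ¬p refl
...   | ()

Extremal : (n : ℕ) → Graph n
Extremal n = record { adj = extAdj ; adj-sym = extAdj-sym ; irrefl = extAdj-irrefl }

{-# OPTIONS --safe #-}
module Submission where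

-- Let S be the set of vertices of degree n − 4, z the unique non-peripheral
-- vertex, and suppose |S| ≥ n − 5.  A vertex v ≠ z in S has exactly three
-- non-neighbours u, x, y; as degrees are at most n − 4, z has eccentricity at
-- least 2, so one of them, say u, is at distance at least 3 from v, and u ~ x for
-- another.  If the diameter exceeds 3, two vertices have eccentricity at most 3; if
-- it is 3 and u ≁ y, then z = x and z cannot reach y in two steps.  Otherwise
-- N(u) = {x, y}, and every w ≠ z in N[v] adjacent to x (or y) must be at distance 3
-- from y (or x).  This forces x ≁ y, z ~ x and z ~ y, and provides w ~ x and w′ ~ y.
-- Now u, w and w′ have degree below n − 4.  A further common member of N[v] and
-- N(x) or N(y) would raise the number of such vertices to six; hence they are
-- u, w, w′, x, y, all remaining vertices have degree n − 4, and all adjacencies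
-- are determined: z, x, y, w, u, w′ play the roles of h, b, c, sab, sbc, sca.

open import Defs
open import Data.Bool using (Bool; true; false)
import Data.Bool.Properties as Bool
open import Data.Empty using (⊥-elim)
open import Data.Fin using (Fin; zero; suc; _≟_)
open import Data.Fin.Patterns
open import Data.Fin.Permutation using (Permutation′; transpose; _∘ₚ_; _⟨$⟩ʳ_)
import Data.Fin.Permutation as Perm
import Data.Fin.Properties as Fin
open import Data.Fin.Subset using (Subset; inside; outside; _-_; ∁; ∣_∣)
  renaming (_∈_ to _∈ˢ_; _∉_ to _∉ˢ_)
open import Data.Fin.Subset.Properties
  using (_∈?_; nonempty?; Empty-unique; ∣⊥∣≡0; p─⊥≡p; p─q⊆p; x∈p∧x≢y⇒x∈p-y; x∈p⇒∣p-x∣<∣p∣;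
         ∣p∣≤n; ∣∁p∣≡n∸∣p∣; x∈∁p⇒x∉p; x∉p⇒x∈∁p; ⊆-antisym)
open import Data.List using (List; []; _∷_; length; map)
open import Data.List.Membership.Propositional using (_∈_; lose)
open import Data.List.Membership.Propositional.Properties using (∈-map⁺; ∈-map⁻)
open import Data.List.Relation.Unary.All using (All; []; _∷_)
import Data.List.Relation.Unary.All as All
open import Data.List.Relation.Unary.All.Properties using (¬Any⇒All¬)
open import Data.List.Relation.Unary.AllPairs using (AllPairs; []; _∷_)
import Data.List.Relation.Unary.AllPairs as AllPairs
import Data.List.Relation.Unary.AllPairs.Properties as AllPairsₚ
open import Data.List.Relation.Unary.Any using (here; there; any?; satisfied)
open import Data.List.Relation.Unary.Unique.DecPropositional using (unique?)
open import Data.List.Relation.Unary.Unique.Propositional using (Unique)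
import Data.List.Relation.Unary.Unique.Propositional.Properties as Unique
open import Data.Nat using (ℕ; zero; suc; _+_; _∸_; _≤_; _<_; z≤n; s≤s; s≤s⁻¹)
import Data.Nat.Properties as ℕ
open import Data.Product using (∃; ∃₂; _×_; _,_; proj₁; proj₂)
open import Data.Sum using (_⊎_; inj₁; inj₂; [_,_]′)
open import Data.Vec using (Vec; []; _∷_; lookup; tabulate; here; there)
import Data.Vec.Properties as Vec
open import Data.Vec.Relation.Unary.All using ([]; _∷_)
open import Data.Vec.Relation.Unary.AllPairs using ([]; _∷_)
import Data.Vec.Relation.Unary.Unique.Propositional as Vec using (Unique)
import Data.Vec.Relation.Unary.Unique.Propositional.Properties as Vec using (lookup-injective)
open import Function using (_∘_; mk⇔; Equivalence; Injection)
open import Function.Properties.Inverse using (↔⇒↣)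
open import Level using (0ℓ)
open import Relation.Binary using (Rel)
open import Relation.Binary.PropositionalEquality
open import Relation.Nullary using (Dec; yes; no; ¬_; does; contradiction)
open import Relation.Nullary.Decidable
  using (map′; decidable-stable; fromSum; True; toWitness; from-yes; dec-true; dec-false;
         ¬?; _⊎-dec_; _×-dec_; _→-dec_)
open import Relation.Unary using (Decidable)

private variable
  n : ℕ

-- Counting

∣p∣≤1+∣p-x∣ : ∀ (p : Subset n) x → ∣ p ∣ ≤ suc ∣ p - x ∣
∣p∣≤1+∣p-x∣ (inside  ∷ p) zero    = s≤s (ℕ.≤-reflexive (cong ∣_∣ (sym (p─⊥≡p p))))
∣p∣≤1+∣p-x∣ (outside ∷ p) zero    = ℕ.≤-trans (ℕ.≤-reflexive (cong ∣_∣ (sym (p─⊥≡p p)))) (ℕ.n≤1+n _)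
∣p∣≤1+∣p-x∣ (inside  ∷ p) (suc x) = s≤s (∣p∣≤1+∣p-x∣ p x)
∣p∣≤1+∣p-x∣ (outside ∷ p) (suc x) = ∣p∣≤1+∣p-x∣ p x

x∉p-x : ∀ (p : Subset n) x → x ∉ˢ p - x
x∉p-x (_ ∷ p) (suc x) (there x∈) = x∉p-x p x x∈

unique⇒length≤∣p∣ : ∀ (p : Subset n) {xs} → Unique xs → All (_∈ˢ p) xs → length xs ≤ ∣ p ∣
unique⇒length≤∣p∣ p []         []           = z≤n
unique⇒length≤∣p∣ p (x≢ ∷ uxs) (x∈p ∷ xs∈p) = ℕ.≤-<-trans
  (unique⇒length≤∣p∣ (p - _) uxs
    (All.zipWith (λ (x≢y , y∈p) → x∈p∧x≢y⇒x∈p-y y∈p (x≢y ∘ sym)) (x≢ , xs∈p)))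
  (x∈p⇒∣p-x∣<∣p∣ x∈p)

length<∣p∣⇒∃ : ∀ (p : Subset n) xs → length xs < ∣ p ∣ → ∃ λ y → y ∈ˢ p × All (y ≢_) xs
length<∣p∣⇒∃ {n} p [] 0<∣p∣ with nonempty? p
... | yes (y , y∈p) = y , y∈p , []
... | no empty = contradiction (trans (cong ∣_∣ (Empty-unique empty)) (∣⊥∣≡0 n)) (ℕ.>⇒≢ 0<∣p∣)
length<∣p∣⇒∃ p (x ∷ xs) l<
  with y , y∈ , y≢ ← length<∣p∣⇒∃ (p - x) xs (s≤s⁻¹ (ℕ.≤-trans l< (∣p∣≤1+∣p-x∣ p x)))
  = y , p─q⊆p p _ y∈ , (λ { refl → x∉p-x p x y∈ }) ∷ y≢

module _ {n} {P : Fin n → Set} where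

  private
    n-k+k : ∀ {k} → NumWith P k → n ∸ k + k ≡ n
    n-k+k (S , refl , _) = ℕ.m∸n+n≡m (∣p∣≤n S)

    ∣∁∣ : ∀ {k} ((S , _) : NumWith P k) → ∣ ∁ S ∣ ≡ n ∸ k
    ∣∁∣ (S , refl , _) = ∣∁p∣≡n∸∣p∣ S

  abstract
    -- A property such as `Peripheral` brings no decision procedure of its own; the subset that
    -- counts it supplies one.
    numWith-dec : ∀ {k} → NumWith P k → Decidable P
    numWith-dec (S , _ , S⇔P) a = map′ (Equivalence.to (S⇔P a)) (Equivalence.from (S⇔P a)) (a ∈? S)

    numWith-outside-≤ : ∀ {k xs} → NumWith P k → Unique xs → All (¬_ ∘ P) xs → length xs + k ≤ n
    numWith-outside-≤ {k} {xs} num@(S , _ , S⇔P) uxs ¬xs = begin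
      length xs + k  ≤⟨ ℕ.+-monoˡ-≤ k (unique⇒length≤∣p∣ (∁ S) uxs
                          (All.map (λ ¬Px → x∉p⇒x∈∁p (¬Px ∘ Equivalence.to (S⇔P _))) ¬xs)) ⟩
      ∣ ∁ S ∣ + k    ≡⟨ cong (_+ k) (∣∁∣ num) ⟩
      n ∸ k + k      ≡⟨ n-k+k num ⟩
      n              ∎
      where open ℕ.≤-Reasoning

    numWith-∃outside : ∀ {k} xs → NumWith P k → length xs + k < n → ∃ λ y → ¬ P y × All (y ≢_) xs
    numWith-∃outside {k} xs num@(S , _ , S⇔P) l<
      with y , y∈ , y≢ ← length<∣p∣⇒∃ (∁ S) xs
             (ℕ.+-cancelʳ-< k (length xs) _ (ℕ.<-≤-trans l< (ℕ.≤-reflexive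
               (sym (trans (cong (_+ k) (∣∁∣ num)) (n-k+k num))))))
      = y , x∈∁p⇒x∉p y∈ ∘ Equivalence.from (S⇔P y) , y≢

    numWith-∃inside : ∀ {k} xs → NumWith P k → length xs < k → ∃ λ y → P y × All (y ≢_) xs
    numWith-∃inside xs (S , refl , S⇔P) l<
      with y , y∈ , y≢ ← length<∣p∣⇒∃ S xs l< = y , Equivalence.to (S⇔P y) y∈ , y≢

    numWith-unique : ∀ {j k} → NumWith P j → NumWith P k → j ≡ k
    numWith-unique (S , refl , S⇔P) (T , refl , T⇔P) = cong ∣_∣ (⊆-antisym
      (λ {a} → Equivalence.from (T⇔P a) ∘ Equivalence.to (S⇔P a))
      (λ {a} → Equivalence.from (S⇔P a) ∘ Equivalence.to (T⇔P a)))

tabulate-numWith : ∀ (f : Fin n → Bool) → NumWith (λ a → f a ≡ true) ∣ tabulate f ∣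
tabulate-numWith f = tabulate f , refl , λ a → mk⇔
  (λ a∈ → trans (sym (Vec.lookup∘tabulate f a)) (Vec.[]=⇒lookup a∈))
  (λ fa → Vec.lookup⇒[]= a (tabulate f) (trans (Vec.lookup∘tabulate f a) fa))

-- If the complement were larger than `xs`, it would contain an outsider missing from the list,
-- which `cover` excludes.
numWith-outsiders : ∀ {P : Fin n → Set} {xs} → Unique xs → All (¬_ ∘ P) xs →
                    (∀ a → P a ⊎ a ∈ xs) → NumWith P (n ∸ length xs)
numWith-outsiders {n} {P} {xs} uxs ¬xs cover = subst (NumWith P) size num
  where
  P? : Decidable P
  P? a = fromSum ([ inj₁ , inj₂ ∘ All.lookup ¬xs ]′ (cover a))

  num : NumWith P ∣ tabulate (does ∘ P?) ∣
  num with S , e , S⇔ ← tabulate-numWith (does ∘ P?) = S , e , λ a → mk⇔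
    (λ a∈ → true⇒P (P? a) (Equivalence.to (S⇔ a) a∈))
    (λ Pa → Equivalence.from (S⇔ a) (dec-true (P? a) Pa))
    where
    true⇒P : ∀ {a} (d : Dec (P a)) → does d ≡ true → P a
    true⇒P (yes Pa) _ = Pa

  size : ∣ tabulate (does ∘ P?) ∣ ≡ n ∸ length xs
  size with ℕ.m≤n⇒m<n∨m≡n (numWith-outside-≤ num uxs ¬xs)
  ... | inj₂ e = trans (sym (ℕ.m+n∸m≡n (length xs) _)) (cong (_∸ length xs) e)
  ... | inj₁ l< with y , ¬Py , y≢ ← numWith-∃outside xs num l< =
    ⊥-elim ([ ¬Py , (λ y∈ → All.lookup y≢ y∈ refl) ]′ (cover y))

-- Walks and eccentricities

module Walks {n} (G : Graph n) where

  infix 4 _~_ _≈_ _~?_ _≈?_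

  -- `v ≈ a` is membership of a in the closed neighbourhood N[v].
  _~_ _≈_ : Fin n → Fin n → Set
  a ~ b = adj G a b ≡ true
  a ≈ b = a ≡ b ⊎ a ~ b

  _~?_ : ∀ a b → Dec (a ~ b)
  a ~? b = adj G a b Bool.≟ true

  _≈?_ : ∀ a b → Dec (a ≈ b)
  a ≈? b = a ≟ b ⊎-dec a ~? b

  ~-sym : ∀ {a b} → a ~ b → b ~ a
  ~-sym {a} {b} = trans (adj-sym G b a)

  ~-irrefl : ∀ {a} → ¬ a ~ a
  ~-irrefl {a} a~a with () ← trans (sym a~a) (irrefl G a)

  degree-numWith : ∀ a → NumWith (a ~_) (degree G a)
  degree-numWith a = tabulate-numWith (adj G a)

  reach-refl : ∀ k {a} → Reach G k a a
  reach-refl zero    = refl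
  reach-refl (suc k) = inj₁ (reach-refl k)

  reach-mono : ∀ {j k a b} → j ≤ k → Reach G j a b → Reach G k a b
  reach-mono {k = k} z≤n refl = reach-refl k
  reach-mono (s≤s j≤k) (inj₁ r) = inj₁ (reach-mono j≤k r)
  reach-mono (s≤s j≤k) (inj₂ (c , r , c~b)) = inj₂ (c , reach-mono j≤k r , c~b)

  reach-cons : ∀ k {a b c} → a ~ b → Reach G k b c → Reach G (suc k) a c
  reach-cons zero    a~b refl = inj₂ (_ , refl , a~b)
  reach-cons (suc k) a~b (inj₁ r) = inj₁ (reach-cons k a~b r)
  reach-cons (suc k) a~b (inj₂ (d , r , d~c)) = inj₂ (d , reach-cons k a~b r , d~c)

  -- `Reach` appends edges at the far end, while later arguments branch on the first edge of a walk.
  reach-uncons : ∀ k {a c} → Reach G (suc k) a c → a ≡ c ⊎ ∃ λ b → a ~ b × Reach G k b c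
  reach-uncons zero (inj₁ a≡c) = inj₁ a≡c
  reach-uncons zero (inj₂ (_ , refl , a~c)) = inj₂ (_ , a~c , refl)
  reach-uncons (suc k) (inj₁ r) with reach-uncons k r
  ... | inj₁ a≡c = inj₁ a≡c
  ... | inj₂ (b , a~b , r′) = inj₂ (b , a~b , inj₁ r′)
  reach-uncons (suc k) (inj₂ (d , r , d~c)) with reach-uncons k r
  ... | inj₁ refl = inj₂ (_ , d~c , reach-refl (suc k))
  ... | inj₂ (b , a~b , r′) = inj₂ (b , a~b , inj₂ (d , r′ , d~c))

  reach-sym : ∀ k {a b} → Reach G k a b → Reach G k b a
  reach-sym zero    r = sym r
  reach-sym (suc k) (inj₁ r) = inj₁ (reach-sym k r)
  reach-sym (suc k) (inj₂ (c , r , c~b)) = reach-cons k (~-sym c~b) (reach-sym k r)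

  reach? : ∀ k a b → Dec (Reach G k a b)
  reach? zero    a b = a ≟ b
  reach? (suc k) a b = reach? k a b ⊎-dec Fin.any? λ c → reach? k a c ×-dec c ~? b

  ¬reach⇒isDist : ∀ {k a b} → ¬ Reach G k a b → Reach G (suc k) a b → IsDist G a b (suc k)
  ¬reach⇒isDist ¬r r = r , λ j rⱼ → ℕ.≰⇒> λ j≤k → ¬r (reach-mono j≤k rⱼ)

  reach⇒isDist : ∀ k {a b} → Reach G k a b → ∃ (IsDist G a b)
  reach⇒isDist zero    r = zero , r , λ _ _ → z≤n
  reach⇒isDist (suc k) {a} {b} r with reach? k a b
  ... | yes r′ = reach⇒isDist k r′
  ... | no ¬r  = suc k , ¬reach⇒isDist ¬r r

  -- Turns connectivity into concrete edges: applied to {u} it yields a neighbour of u, applied to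
  -- N[v] an edge leaving N[v].
  crossing : ∀ {P : Fin n → Set} → Decidable P → ∀ k {a b} → P a → ¬ P b → Reach G k a b →
             ∃₂ λ c d → P c × ¬ P d × c ~ d
  crossing P? zero    Pa ¬Pb refl     = contradiction Pa ¬Pb
  crossing P? (suc k) Pa ¬Pb (inj₁ r) = crossing P? k Pa ¬Pb r
  crossing P? (suc k) Pa ¬Pb (inj₂ (c , r , c~b)) with P? c
  ... | yes Pc = c , _ , Pc , ¬Pb , c~b
  ... | no ¬Pc = crossing P? k Pa ¬Pc r

  Near : Fin n → Fin n → Set
  Near = Reach G 2

  near-sym : ∀ {a b} → Near a b → Near b a
  near-sym = reach-sym 2

  near₁ : ∀ {a b} → a ~ b → Near a b
  near₁ a~b = inj₁ (inj₂ (_ , refl , a~b))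

  near₂ : ∀ {a c b} → a ~ c → c ~ b → Near a b
  near₂ a~c c~b = inj₂ (_ , inj₂ (_ , refl , a~c) , c~b)

  near-view : ∀ {a b} → Near a b → a ≡ b ⊎ a ~ b ⊎ ∃ λ c → a ~ c × c ~ b
  near-view (inj₁ (inj₁ a≡b)) = inj₁ a≡b
  near-view (inj₁ (inj₂ (_ , refl , a~b))) = inj₂ (inj₁ a~b)
  near-view (inj₂ (_ , inj₁ refl , a~b)) = inj₂ (inj₁ a~b)
  near-view (inj₂ (c , inj₂ (_ , refl , a~c) , c~b)) = inj₂ (inj₂ (c , a~c , c~b))

  ≈⇒reach₁ : ∀ {a b} → a ≈ b → Reach G 1 a b
  ≈⇒reach₁ (inj₁ a≡b) = inj₁ a≡b
  ≈⇒reach₁ (inj₂ a~b) = inj₂ (_ , refl , a~b)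

  -- The walk passes through c. With c = v, each member of N[v] is near all of N[v], so a vertex far
  -- from it must be u, x or y.
  ≈-near : ∀ {c a b} → c ≈ a → c ≈ b → Near a b
  ≈-near (inj₁ refl) c≈b = inj₁ (≈⇒reach₁ c≈b)
  ≈-near (inj₂ c~a) (inj₁ refl) = near₁ (~-sym c~a)
  ≈-near (inj₂ c~a) (inj₂ c~b) = near₂ (~-sym c~a) c~b

  isDiam-unique : ∀ {D D′} → IsDiam G D → IsDiam G D′ → D ≡ D′
  isDiam-unique (≤D , a , ecc) (≤D′ , b , ecc′) = ℕ.≤-antisym (≤D′ a _ ecc) (≤D b _ ecc′)

  -- Encodes that the diameter is `suc e` and that z alone has eccentricity at most `e`; bounded
  -- walks take the place of exact distances.
  record Centred (z : Fin n) (e : ℕ) : Set where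
    field
      diameter  : ∀ a b → Reach G (suc e) a b
      far       : ∀ {a} → a ≢ z → ∃ λ b → ¬ Reach G e a b
      centre    : ∀ a → Reach G e z a

  almostPeripheral⇒centred : 3 ≤ n → AlmostPeripheral G → ∃₂ Centred
  almostPeripheral⇒centred (s≤s (s≤s (s≤s _))) (connected , num)
    with z , ¬Pz , _ ← numWith-∃outside [] num ℕ.≤-refl
    with v₀ , (D , isDiam , isEcc₀) , v₀≢z ∷ [] ← numWith-∃inside (z ∷ []) num (s≤s (s≤s z≤n))
    = z , centred D isDiam
    where
    isEcc : ∀ {D} → IsDiam G D → ∀ {a} → a ≢ z → IsEcc G a D
    isEcc isDiam {a} a≢z with numWith-dec num a
    ... | yes (D′ , isDiam′ , ecc) = subst (IsEcc G a) (isDiam-unique isDiam′ isDiam) ecc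
    -- A second non-peripheral vertex besides z would give 2 + (n - 1) ≤ n.
    ... | no ¬Pa = contradiction (numWith-outside-≤ num ((a≢z ∷ []) ∷ [] ∷ []) (¬Pa ∷ ¬Pz ∷ []))
                             (ℕ.<-irrefl refl)

    reach : ∀ {D} → IsDiam G D → ∀ {a} → a ≢ z → ∀ b → Reach G D a b
    reach isDiam {a} a≢z b with k , r ← connected a b with j , d ← reach⇒isDist k r
      = reach-mono (proj₁ (isEcc isDiam a≢z) b j d) (proj₁ d)

    centred : ∀ D → IsDiam G D → ∃ (Centred z)
    centred zero isDiam = contradiction (reach isDiam v₀≢z z) v₀≢z
    centred (suc e) isDiam = e , record
      { diameter = diameter
      ; far      = λ a≢z → let b , _ , min = proj₂ (isEcc isDiam a≢z)
                           in b , λ r → ℕ.<-irrefl refl (min e r)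
      -- Were z unable to reach a within `e` steps, a would be at distance `suc e` and z would be
      -- peripheral.
      ; centre   = λ a → decidable-stable (reach? e z a) λ ¬r →
                     ¬Pz (suc e , isDiam , (λ b k d → proj₂ d (suc e) (diameter z b)) , a
                         , ¬reach⇒isDist ¬r (diameter z a))
      }
      where
      diameter : ∀ a b → Reach G (suc e) a b
      diameter a b with a ≟ z | b ≟ z
      ... | no a≢z   | _        = reach isDiam a≢z b
      ... | yes _    | no b≢z   = reach-sym (suc e) (reach isDiam b≢z a)
      ... | yes refl | yes refl = reach-refl (suc e)

pattern 4+ m = suc (suc (suc (suc m)))
pattern 6+ m = 4+ (suc (suc m))
pattern 8+ m = 4+ (4+ m)

-- The neighbourhood of a vertex of degree n − 4

module Full {m} (G : Graph (8+ m)) where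
  open Walks G

  Full : Fin (8+ m) → Set
  Full a = degree G a ≡ 4+ m

  full? : Decidable Full
  full? a = degree G a ℕ.≟ 4+ m

  -- The lists used for `xs` contain a itself. Counted this way, a vertex of degree n - 4 has
  -- exactly four non-neighbours, so five are too many.
  ¬full : ∀ {a xs} → 4 < length xs → Unique xs → All (λ b → ¬ a ~ b) xs → ¬ Full a
  ¬full {a} 4<l uxs ≁xs full = ℕ.<⇒≱ 4<l (ℕ.+-cancelʳ-≤ (4+ m) _ 4
    (subst (λ d → _ + d ≤ 8+ m) full (numWith-outside-≤ (degree-numWith a) uxs ≁xs)))

  -- The three other vertices outside N(v): u at distance at least three from v, its neighbour x,
  -- and the remaining one y.
  record Corner (v u x y : Fin (8+ m)) : Set where
    field
      v≢u : v ≢ u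
      v≢x : v ≢ x
      v≢y : v ≢ y
      u≢x : u ≢ x
      u≢y : u ≢ y
      x≢y : x ≢ y
      v≁u : ¬ v ~ u
      v≁x : ¬ v ~ x
      v≁y : ¬ v ~ y
      u~x : u ~ x
      remote : ¬ Near v u
      others : ∀ a → a ≢ u → a ≢ x → a ≢ y → v ≈ a

  data Location (v u x y a : Fin (8+ m)) : Set where
    at-u  : a ≡ u → Location v u x y a
    at-x  : a ≡ x → Location v u x y a
    at-y  : a ≡ y → Location v u x y a
    close : v ≈ a → Location v u x y a

  module Corners {v u x y} (corner : Corner v u x y) where
    open Corner corner public

    locate : ∀ a → Location v u x y a
    locate a with a ≟ u | a ≟ x | a ≟ y
    ... | yes a≡u | _       | _       = at-u a≡u
    ... | no _    | yes a≡x | _       = at-x a≡x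
    ... | no _    | no _    | yes a≡y = at-y a≡y
    ... | no a≢u  | no a≢x  | no a≢y  = close (others a a≢u a≢x a≢y)

    ¬close-u : ¬ v ≈ u
    ¬close-u = [ v≢u , v≁u ]′

    ¬close-x : ¬ v ≈ x
    ¬close-x = [ v≢x , v≁x ]′

    -- A neighbour of u in N[v] would put u within distance two of v. Hence N(u) is contained in {x,
    -- y}.
    close≁u : ∀ {a} → v ≈ a → ¬ a ~ u
    close≁u (inj₁ refl) = v≁u
    close≁u (inj₂ v~a) a~u = remote (near₂ v~a a~u)

    u-neighbours : ∀ {a} → u ~ a → a ≡ x ⊎ a ≡ y
    u-neighbours {a} u~a with locate a
    ... | at-u refl = contradiction u~a ~-irrefl
    ... | at-x a≡x  = inj₁ a≡x
    ... | at-y a≡y  = inj₂ a≡y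
    ... | close v≈a = contradiction (~-sym u~a) (close≁u v≈a)

  -- Once u ~ y is known, x and y are interchangeable, so each later fact about x has a mirror image
  -- about y.
  corner-swap : ∀ {v u x y} → Corner v u x y → u ~ y → Corner v u y x
  corner-swap c u~y = record
    { v≢u = v≢u ; v≢x = v≢y ; v≢y = v≢x ; u≢x = u≢y ; u≢y = u≢x ; x≢y = x≢y ∘ sym
    ; v≁u = v≁u ; v≁x = v≁y ; v≁y = v≁x ; u~x = u~y ; remote = remote
    ; others = λ a a≢u a≢y a≢x → others a a≢u a≢x a≢y }
    where open Corner c

  full-corner : Connected G → ∀ {v u} → Full v → ¬ Near v u → ∃₂ (Corner v u)
  full-corner connected {v} {u} full remote
    -- A walk from u to v leaves {u} along an edge; its other end serves as x.
    with _ , x , refl , u≢x , u~x ← crossing (u ≟_) (proj₁ (connected u v)) refl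
           (λ { refl → remote (reach-refl 2) }) (proj₂ (connected u v))
    -- Counting v itself, v has four non-neighbours; v, u and x are three of them and y is the
    -- fourth.
    with y , v≁y , y≢v ∷ y≢u ∷ y≢x ∷ [] ← numWith-∃outside (v ∷ u ∷ x ∷ []) (degree-numWith v)
           (ℕ.≤-reflexive (cong 4+ full))
    = x , y , record
    { v≢u = v≢u ; v≢x = v≢x ; v≢y = y≢v ∘ sym
    ; u≢x = u≢x ; u≢y = y≢u ∘ sym ; x≢y = y≢x ∘ sym
    ; v≁u = remote ∘ near₁ ; v≁x = v≁x ; v≁y = v≁y ; u~x = u~x ; remote = remote
    ; others = others }
    where
    v≢u : v ≢ u
    v≢u refl = remote (reach-refl 2)
    v≢x : v ≢ x
    v≢x refl = remote (near₁ (~-sym u~x))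
    v≁x : ¬ v ~ x
    v≁x v~x = remote (near₂ v~x (~-sym u~x))
    others : ∀ a → a ≢ u → a ≢ x → a ≢ y → v ≈ a
    others a a≢u a≢x a≢y = decidable-stable (v ≈? a) λ v≉a → ¬full ℕ.≤-refl
      ((v≉a ∘ inj₁ ∷ v≢u ∷ v≢x ∷ y≢v ∘ sym ∷ []) ∷ (a≢u ∷ a≢x ∷ a≢y ∷ [])
        ∷ (u≢x ∷ y≢u ∘ sym ∷ []) ∷ (y≢x ∘ sym ∷ []) ∷ [] ∷ [])
      (~-irrefl ∷ v≉a ∘ inj₂ ∷ remote ∘ near₁ ∷ v≁x ∷ v≁y ∷ [])
      full

  -- Beyond distance 3 the path leaving N[v] runs w, y, x, u, and both w and y
  -- are within distance 3 of everything.
  near-corner : ∀ {z v u x y} → Connected G → (∀ {a} → a ≢ z → ∃ λ b → ¬ Reach G 3 a b) →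
                Corner v u x y → Reach G 3 v u
  near-corner {z} {v} {u} {x} {y} connected far corner = decidable-stable (reach? 3 v u) impossible
    where
    open Corners corner

    central : ∀ {a} → (∀ b → Reach G 3 a b) → a ≡ z
    central {a} r = decidable-stable (a ≟ z) λ a≢z → let b , ¬r = far a≢z in ¬r (r b)

    impossible : ¬ ¬ Reach G 3 v u
    -- Only z can be within distance three of everything, so the adjacent vertices w and y would
    -- both be z.
    impossible ¬r = ~-irrefl (subst₂ _~_ (central w-central) (central y-central) w~y)
      where
      close≁x : ∀ {a} → v ≈ a → ¬ a ~ x
      close≁x v≈a a~x = ¬r (inj₂ (x , inj₂ (_ , ≈⇒reach₁ v≈a , a~x) , ~-sym u~x))

      w-y : ∃ λ w → v ≈ w × w ~ y
      w-y with c , d , v≈c , v≉d , c~d ← crossing (v ≈?_) (proj₁ (connected v u)) (inj₁ refl)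
                 ¬close-u (proj₂ (connected v u)) with locate d
      ... | at-u refl = contradiction c~d (close≁u v≈c)
      ... | at-x refl = contradiction c~d (close≁x v≈c)
      ... | at-y refl = c , v≈c , c~d
      ... | close v≈d = contradiction v≈d v≉d

      w = proj₁ w-y
      v≈w = proj₁ (proj₂ w-y)
      w~y = proj₂ (proj₂ w-y)

      y~x : y ~ x
      -- The walk must also leave N[v] ∪ {y}; a step from y straight to u would bring u within three
      -- steps of v.
      y~x with c , d , c∈ , d∉ , c~d ← crossing (λ a → v ≈? a ⊎-dec a ≟ y) (proj₁ (connected v u))
                 (inj₁ (inj₁ refl)) [ ¬close-u , u≢y ]′ (proj₂ (connected v u)) with c∈ | locate d
      ... | _         | at-y d≡y  = contradiction (inj₂ d≡y) d∉
      ... | _         | close v≈d = contradiction (inj₁ v≈d) d∉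
      ... | inj₁ v≈c  | at-u refl = contradiction c~d (close≁u v≈c)
      ... | inj₁ v≈c  | at-x refl = contradiction c~d (close≁x v≈c)
      ... | inj₂ refl | at-x refl = c~d
      ... | inj₂ refl | at-u refl =
        contradiction (inj₂ (y , inj₂ (w , ≈⇒reach₁ v≈w , w~y) , c~d)) ¬r

      w-central : ∀ b → Reach G 3 w b
      w-central b with locate b
      ... | at-u refl = inj₂ (x , near₂ w~y y~x , ~-sym u~x)
      ... | at-x refl = inj₁ (near₂ w~y y~x)
      ... | at-y refl = inj₁ (near₁ w~y)
      ... | close v≈b = inj₁ (≈-near v≈w v≈b)

      y-central : ∀ b → Reach G 3 y b
      y-central b with locate b
      ... | at-u refl = inj₁ (near₂ y~x (~-sym u~x))
      ... | at-x refl = inj₁ (near₁ y~x)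
      ... | at-y refl = reach-refl 3
      ... | close v≈b = reach-cons 2 (~-sym w~y) (≈-near v≈w v≈b)

  -- Diameter three: the surroundings of a vertex of degree n - 4

  module DiameterThree {z} (diameter : ∀ a b → Reach G 3 a b)
    (far : ∀ {a} → a ≢ z → ∃ λ b → ¬ Near a b) (centre : ∀ a → Near z a) where

    -- If u ≁ y, then x is the only neighbour of u. As u reaches everything in three steps, x does
    -- so in two, whence x = z. Now every neighbour of x in N[v] must be far from y, and one such
    -- neighbour lies between z and v; this blocks all walks of at most two steps from z to y.
    corner⇒u~y : ∀ {v u x y} → v ≢ z → Corner v u x y → u ~ y
    corner⇒u~y {v} {u} {x} {y} v≢z corner = decidable-stable (u ~? y) impossible
      where
      open Corners corner

      impossible : ¬ ¬ u ~ y
      impossible u≁y = contra (near-view (centre v))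
        where
        u-neighbour : ∀ {a} → u ~ a → a ≡ x
        u-neighbour u~a with u-neighbours u~a
        ... | inj₁ a≡x  = a≡x
        ... | inj₂ refl = contradiction u~a u≁y

        x-central : ∀ b → Near x b
        x-central b with reach-uncons 2 (diameter u b)
        ... | inj₁ refl = near₁ (~-sym u~x)
        ... | inj₂ (a , u~a , r) with refl ← u-neighbour u~a = r

        x≡z : x ≡ z
        x≡z = decidable-stable (x ≟ z) λ x≢z → let b , ¬r = far x≢z in ¬r (x-central b)

        z~ : ∀ {a} → z ~ a → x ~ a
        z~ {a} = subst (_~ a) (sym x≡z)

        x-neighbour : ∀ {a} → v ≈ a → x ~ a → ¬ Near a y
        x-neighbour {a} v≈a x~a near-y with far (λ a≡z → ~-irrefl (subst₂ _~_ x≡z a≡z x~a))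
        ... | b , ¬r with locate b
        ... | at-u refl = ¬r (near₂ (~-sym x~a) (~-sym u~x))
        ... | at-x refl = ¬r (near₁ (~-sym x~a))
        ... | at-y refl = ¬r near-y
        ... | close v≈b = ¬r (≈-near v≈a v≈b)

        contra : ¬ (z ≡ v ⊎ z ~ v ⊎ ∃ λ c → z ~ c × c ~ v)
        contra (inj₁ z≡v) = v≢z (sym z≡v)
        contra (inj₂ (inj₁ z~v)) = v≁x (~-sym (z~ z~v))
        contra (inj₂ (inj₂ (w , z~w , w~v))) with near-view (centre y)
        ... | inj₁ z≡y = x≢y (trans x≡z z≡y)
        ... | inj₂ (inj₁ z~y) = x-neighbour (inj₂ (~-sym w~v)) (z~ z~w) (near₂ (~-sym (z~ z~w)) (z~ z~y))
        ... | inj₂ (inj₂ (c , z~c , c~y)) with locate c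
        ... | at-u refl = u≁y c~y
        ... | at-x refl = ~-irrefl (z~ z~c)
        ... | at-y refl = ~-irrefl c~y
        ... | close v≈c = x-neighbour v≈c (z~ z~c) (near₁ c~y)

    module _ {v u x y} (v≢z : v ≢ z) (corner : Corner v u x y) where
      open Corners corner

      -- Such a w is near all of N[v] through v and near u through x, so the vertex far from it can
      -- only be y.
      x-side : ∀ {w} → v ≈ w → w ~ x → w ≢ z → ¬ Near w y
      x-side v≈w w~x w≢z near-y with far w≢z
      ... | b , ¬r with locate b
      ... | at-u refl = ¬r (near₂ w~x (~-sym u~x))
      ... | at-x refl = ¬r (near₁ w~x)
      ... | at-y refl = ¬r near-y
      ... | close v≈b = ¬r (≈-near v≈w v≈b)

    module _ {v u x y} (v≢z : v ≢ z) (corner : Corner v u x y) where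
      open Corners corner

      private
        corner′ : Corner v u y x
        corner′ = corner-swap corner (corner⇒u~y v≢z corner)

      -- With z = x, the two-step walk from z to v passes a w in N[v] that is far from y. Let b be
      -- the first vertex after y on a walk of at most three steps to v. If b is x or z, then w is
      -- near y. Any other b in N[v] is far from x by the mirrored `x-side`, although x = z is near
      -- everything.
      z≢x : z ≢ x
      z≢x z≡x = contra (near-view (centre v))
        where
        z~ : ∀ {a} → z ~ a → x ~ a
        z~ {a} = subst (_~ a) z≡x

        contra : ¬ (z ≡ v ⊎ z ~ v ⊎ ∃ λ c → z ~ c × c ~ v)
        contra (inj₁ z≡v) = v≢z (sym z≡v)
        contra (inj₂ (inj₁ z~v)) = v≁x (~-sym (z~ z~v))
        contra (inj₂ (inj₂ (w , z~w , w~v))) with reach-uncons 2 (diameter y v)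
        ... | inj₁ y≡v = v≢y (sym y≡v)
        ... | inj₂ (b , y~b , near-v) with locate b
        ... | at-u refl = remote (near-sym near-v)
        ... | at-x refl = x-side v≢z corner (inj₂ (~-sym w~v)) (~-sym (z~ z~w))
                            (λ { refl → ~-irrefl z~w }) (near₂ (~-sym (z~ z~w)) (~-sym y~b))
        ... | at-y refl = ~-irrefl y~b
        ... | close v≈b = x-side v≢z corner′ v≈b (~-sym y~b) b≢z
                            (near-sym (subst (λ c → Near c b) z≡x (centre b)))
          where
          b≢z : b ≢ z
          b≢z refl = x-side v≢z corner (inj₂ (~-sym w~v)) (~-sym (z~ z~w)) (λ { refl → ~-irrefl z~w })
                       (near₂ (~-sym z~w) (~-sym y~b))

      -- Take r far from x and walk from u to r in at most three steps. Starting with x would bring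
      -- r near x, so the walk starts with y and then enters N[v]. Its entry point is w; it is not
      -- z, because z ~ x would again bring r near x.
      y-side-vertex : z ~ x → ∃ λ w → v ≈ w × w ~ y × w ≢ z
      y-side-vertex z~x with r , ¬near ← far (z≢x ∘ sym) with reach-uncons 2 (diameter u r)
      ... | inj₁ refl = contradiction (near₁ (~-sym u~x)) ¬near
      ... | inj₂ (b , u~b , near-r) with u-neighbours u~b
      ... | inj₁ refl = contradiction near-r ¬near
      ... | inj₂ refl with reach-uncons 1 near-r
      ... | inj₁ refl = contradiction (near₂ (~-sym u~x) u~b) ¬near
      ... | inj₂ (c , y~c , c≈r) with locate c
      ... | at-u refl = contradiction (reach-cons 1 (~-sym u~x) c≈r) ¬near
      ... | at-x refl = contradiction (inj₁ c≈r) ¬near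
      ... | at-y refl = contradiction y~c ~-irrefl
      ... | close v≈c = c , v≈c , ~-sym y~c , λ { refl → ¬near (reach-cons 1 (~-sym z~x) c≈r) }

    module _ {v u x y} (v≢z : v ≢ z) (corner : Corner v u x y) where
      open Corners corner

      private
        corner′ : Corner v u y x
        corner′ = corner-swap corner (corner⇒u~y v≢z corner)

      close-z : v ≈ z
      close-z with locate z
      ... | at-u refl = contradiction (near-sym (centre v)) remote
      ... | at-x z≡x  = contradiction z≡x (z≢x v≢z corner)
      ... | at-y z≡y  = contradiction z≡y (z≢x v≢z corner′)
      ... | close v≈z = v≈z

      z~x⇒x≁y : z ~ x → ¬ x ~ y
      z~x⇒x≁y z~x x~y with w , v≈w , w~y , w≢z ← y-side-vertex v≢z corner z~x
        = x-side v≢z corner′ v≈w w~y w≢z (near₂ w~y (~-sym x~y))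

      -- Otherwise z reaches y through some c in N[v], and c, z, x is a two-step walk that the
      -- mirrored `x-side` forbids.
      z~x⇒z~y : z ~ x → z ~ y
      z~x⇒z~y z~x with near-view (centre y)
      ... | inj₁ z≡y = contradiction z≡y (z≢x v≢z corner′)
      ... | inj₂ (inj₁ z~y) = z~y
      ... | inj₂ (inj₂ (c , z~c , c~y)) with locate c
      ... | at-u refl = contradiction z~c (close≁u close-z)
      ... | at-x refl = contradiction c~y (z~x⇒x≁y z~x)
      ... | at-y refl = contradiction c~y ~-irrefl
      ... | close v≈c = contradiction (near₂ (~-sym z~c) z~x)
                          (x-side v≢z corner′ v≈c c~y λ { refl → ~-irrefl z~c })

    module _ {v u x y} (v≢z : v ≢ z) (corner : Corner v u x y) where
      open Corners corner

      -- A two-step walk from z to u enters u through x or y; adjacency to one of them forces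
      -- adjacency to the other.
      corner⇒z~x,z~y : z ~ x × z ~ y
      corner⇒z~x,z~y with near-view (centre u)
      ... | inj₁ refl = contradiction (close-z v≢z corner) ¬close-u
      ... | inj₂ (inj₁ z~u) = contradiction z~u (close≁u (close-z v≢z corner))
      ... | inj₂ (inj₂ (c , z~c , c~u)) with u-neighbours (~-sym c~u)
      ... | inj₁ refl = z~c , z~x⇒z~y v≢z corner z~c
      ... | inj₂ refl = z~x⇒z~y v≢z (corner-swap corner (corner⇒u~y v≢z corner)) z~c , z~c

    record Frame (v u x y w w′ : Fin (8+ m)) : Set where
      field
        v≢z     : v ≢ z
        corner  : Corner v u x y
        u~y      : u ~ y
        v≈z     : v ≈ z
        z~x      : z ~ x
        z~y      : z ~ y
        x≁y     : ¬ x ~ y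
        v≈w     : v ≈ w
        w~x      : w ~ x
        w≢z     : w ≢ z
        v≈w′    : v ≈ w′
        w′~y     : w′ ~ y
        w′≢z    : w′ ≢ z

    frame-swap : ∀ {v u x y w w′} → Frame v u x y w w′ → Frame v u y x w′ w
    frame-swap f = record
      { v≢z = v≢z ; corner = corner-swap corner u~y ; u~y = Corner.u~x corner ; v≈z = v≈z
      ; z~x = z~y ; z~y = z~x ; x≁y = x≁y ∘ ~-sym
      ; v≈w = v≈w′ ; w~x = w′~y ; w≢z = w′≢z ; v≈w′ = v≈w ; w′~y = w~x ; w′≢z = w≢z }
      where open Frame f

    corner⇒frame : ∀ {v u x y} → v ≢ z → Corner v u x y → ∃₂ (Frame v u x y)
    corner⇒frame v≢z corner
      with corner′ ← corner-swap corner (corner⇒u~y v≢z corner)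
      with z~x , z~y ← corner⇒z~x,z~y v≢z corner
      -- Applied to the swapped corner, the construction beside y gives a vertex beside x.
      with w , v≈w , w~x , w≢z ← y-side-vertex v≢z corner′ z~y
      with w′ , v≈w′ , w′~y , w′≢z ← y-side-vertex v≢z corner z~x
      = w , w′ , record
      { v≢z = v≢z ; corner = corner ; u~y = corner⇒u~y v≢z corner ; v≈z = close-z v≢z corner
      ; z~x = z~x ; z~y = z~y ; x≁y = z~x⇒x≁y v≢z corner z~x
      ; v≈w = v≈w ; w~x = w~x ; w≢z = w≢z ; v≈w′ = v≈w′ ; w′~y = w′~y ; w′≢z = w′≢z }

    module Frames {v u x y w w′} (frame : Frame v u x y w w′) where
      open Frame frame public
      open Corners corner public

      w-y-far : ¬ Near w y
      w-y-far = x-side v≢z corner v≈w w~x w≢z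

      w≁z : ¬ w ~ z
      w≁z w~z = w-y-far (near₂ w~z z~y)

      w≁w′ : ¬ w ~ w′
      w≁w′ w~w′ = w-y-far (near₂ w~w′ w′~y)

      u≁close : ∀ {a} → v ≈ a → ¬ u ~ a
      u≁close v≈a u~a = close≁u v≈a (~-sym u~a)

      far-x : ∀ {a} → v ≈ a → a ≢ x
      far-x v≈a refl = ¬close-x v≈a

      w≢w′ : w ≢ w′
      w≢w′ refl = w-y-far (near₁ w′~y)

      v≢w : v ≢ w
      v≢w refl = v≁x w~x

    -- Vertices of degree below n - 4

    module Count {v u x y w w′} (frame : Frame v u x y w w′) {t} (v≈t : v ≈ t)
      (t≢v : t ≢ v) (t≢z : t ≢ z) (t≢w : t ≢ w) (t≢w′ : t ≢ w′) where
      open Frames frame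
      private module F′ = Frames (frame-swap frame)

      vertices : Vec (Fin (8+ m)) 8
      vertices = v ∷ u ∷ x ∷ y ∷ z ∷ w ∷ w′ ∷ t ∷ []

      distinct : Vec.Unique vertices
      distinct =
        (v≢u ∷ v≢x ∷ v≢y ∷ v≢z ∷ v≢w ∷ F′.v≢w ∷ t≢v ∘ sym ∷ []) ∷
        (u≢x ∷ u≢y ∷ ≢u v≈z ∷ ≢u v≈w ∷ ≢u v≈w′ ∷ ≢u v≈t ∷ []) ∷
        (x≢y ∷ far-x v≈z ∘ sym ∷ far-x v≈w ∘ sym ∷ far-x v≈w′ ∘ sym ∷ far-x v≈t ∘ sym ∷ []) ∷
        (F′.far-x v≈z ∘ sym ∷ F′.far-x v≈w ∘ sym ∷ F′.far-x v≈w′ ∘ sym ∷ F′.far-x v≈t ∘ sym ∷ []) ∷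
        (w≢z ∘ sym ∷ w′≢z ∘ sym ∷ t≢z ∘ sym ∷ []) ∷
        (w≢w′ ∷ t≢w ∘ sym ∷ []) ∷
        (t≢w′ ∘ sym ∷ []) ∷ [] ∷ []
        where
        ≢u : ∀ {a} → v ≈ a → u ≢ a
        ≢u v≈a refl = ¬close-u v≈a

      -- Reduces distinctness of selected vertices to a decidable comparison of their positions in
      -- `vertices`.
      distinct-at : ∀ is {_ : True (unique? _≟_ is)} → Unique (map (lookup vertices) is)
      distinct-at is {u} = Unique.map⁺ (Vec.lookup-injective distinct _ _) (toWitness u)

      ¬full-u : ¬ Full u
      ¬full-u = ¬full ℕ.≤-refl (distinct-at (1F ∷ 0F ∷ 4F ∷ 5F ∷ 6F ∷ []))
        (~-irrefl ∷ u≁close (inj₁ refl) ∷ u≁close v≈z ∷ u≁close v≈w ∷ u≁close v≈w′ ∷ [])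

      ¬full-w : ¬ Full w
      ¬full-w = ¬full ℕ.≤-refl (distinct-at (5F ∷ 1F ∷ 3F ∷ 4F ∷ 6F ∷ []))
        (~-irrefl ∷ close≁u v≈w ∷ w-y-far ∘ near₁ ∷ w≁z ∷ w≁w′ ∷ [])

      ¬full-w′ : ¬ Full w′
      ¬full-w′ = ¬full ℕ.≤-refl (distinct-at (6F ∷ 1F ∷ 2F ∷ 4F ∷ 5F ∷ []))
        (~-irrefl ∷ close≁u v≈w′ ∷ F′.w-y-far ∘ near₁ ∷ F′.w≁z ∷ F′.w≁w′ ∷ [])

      -- The frame provides only four non-neighbours of y, namely y, v, x and w; t is the fifth.
      ¬full-y : ¬ t ~ y → ¬ Full y
      ¬full-y t≁y = ¬full ℕ.≤-refl (distinct-at (3F ∷ 0F ∷ 2F ∷ 5F ∷ 7F ∷ []))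
        (~-irrefl ∷ v≁y ∘ ~-sym ∷ x≁y ∘ ~-sym ∷ w-y-far ∘ near₁ ∘ ~-sym ∷ t≁y ∘ ~-sym ∷ [])

      ¬full-x : ¬ t ~ x → ¬ Full x
      ¬full-x t≁x = ¬full ℕ.≤-refl (distinct-at (2F ∷ 0F ∷ 3F ∷ 6F ∷ 7F ∷ []))
        (~-irrefl ∷ v≁x ∘ ~-sym ∷ x≁y ∷ F′.w-y-far ∘ near₁ ∘ ~-sym ∷ t≁x ∘ ~-sym ∷ [])

      -- Otherwise u, w, w′, t, y and z are six vertices that are not full.
      t≁x : (∀ {xs} → Unique xs → All (¬_ ∘ Full) xs → length xs ≤ 5) → ¬ t ~ x
      t≁x few t~x = ℕ.<-irrefl refl (few (distinct-at (1F ∷ 5F ∷ 6F ∷ 7F ∷ 3F ∷ 4F ∷ []))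
        (¬full-u ∷ ¬full-w ∷ ¬full-w′
          ∷ ¬full ℕ.≤-refl (distinct-at (7F ∷ 1F ∷ 3F ∷ 4F ∷ 6F ∷ []))
              (~-irrefl ∷ close≁u v≈t ∷ t-y-far ∘ near₁ ∷ t≁z ∷ t≁w′ ∷ [])
          ∷ ¬full-y (t-y-far ∘ near₁)
          ∷ ¬full ℕ.≤-refl (distinct-at (4F ∷ 5F ∷ 6F ∷ 7F ∷ 1F ∷ []))
              (~-irrefl ∷ w≁z ∘ ~-sym ∷ F′.w≁z ∘ ~-sym ∷ t≁z ∘ ~-sym ∷ close≁u v≈z ∷ []) ∷ []))
        where
        t-y-far : ¬ Near t y
        t-y-far = x-side v≢z corner v≈t t~x t≢z

        t≁z : ¬ t ~ z
        t≁z t~z = t-y-far (near₂ t~z z~y)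

        t≁w′ : ¬ t ~ w′
        t≁w′ t~w′ = t-y-far (near₂ t~w′ w′~y)

-- Recognising the extremal graph

transpose-left : ∀ {n} (i j : Fin n) → transpose i j ⟨$⟩ʳ i ≡ j
transpose-left i j rewrite dec-true (i ≟ i) refl = refl

transpose-fixed : ∀ {n} {i j k : Fin n} → k ≢ i → k ≢ j → transpose i j ⟨$⟩ʳ k ≡ k
transpose-fixed {i = i} {j} {k} k≢i k≢j rewrite dec-false (k ≟ i) k≢i | dec-false (k ≟ j) k≢j = refl

-- After the tail is placed, a transposition moves the image of `f k` to `g k`. It fixes the images
-- already placed, since they differ from both.
∃permutation : ∀ {n} {A : Set} (f g : A → Fin n) {ks} →
               AllPairs (λ k l → f k ≢ f l) ks → AllPairs (λ k l → g k ≢ g l) ks →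
               ∃ λ (π : Permutation′ n) → All (λ k → π ⟨$⟩ʳ f k ≡ g k) ks
∃permutation f g [] [] = Perm.id , []
∃permutation f g {k ∷ _} (f≢ ∷ fs) (g≢ ∷ gs) with π , eqs ← ∃permutation f g fs gs =
  π ∘ₚ transpose (π ⟨$⟩ʳ f k) (g k) ,
  transpose-left (π ⟨$⟩ʳ f k) (g k) ∷ All.zipWith fixed (eqs , All.zip (f≢ , g≢))
  where
  fixed : ∀ {l} → π ⟨$⟩ʳ f l ≡ g l × f k ≢ f l × g k ≢ g l →
          transpose (π ⟨$⟩ʳ f k) (g k) ⟨$⟩ʳ (π ⟨$⟩ʳ f l) ≡ g l
  fixed (eq , f≢ , g≢) = trans
    (transpose-fixed (λ e → f≢ (sym (Injection.injective (↔⇒↣ π) e))) (λ e → g≢ (trans (sym e) eq))) eq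

allPairs-lookup : ∀ {A : Set} {R : Rel A 0ℓ} {xs x y} → AllPairs R xs → x ∈ xs → y ∈ xs →
                  x ≡ y ⊎ R x y ⊎ R y x
allPairs-lookup (rs ∷ _)  (here refl) (here refl) = inj₁ refl
allPairs-lookup (rs ∷ _)  (here refl) (there y∈)  = inj₂ (inj₁ (All.lookup rs y∈))
allPairs-lookup (rs ∷ _)  (there x∈)  (here refl) = inj₂ (inj₂ (All.lookup rs x∈))
allPairs-lookup (_ ∷ rss) (there x∈)  (there y∈)  = allPairs-lookup rss x∈ y∈

hubs : List Kind
hubs = kh ∷ kb ∷ kc ∷ kab ∷ kbc ∷ kca ∷ []

kA⊎hub : ∀ k → k ≡ kA ⊎ k ∈ hubs
kA⊎hub kh  = inj₂ (here refl)
kA⊎hub kb  = inj₂ (there (here refl))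
kA⊎hub kc  = inj₂ (there (there (here refl)))
kA⊎hub kab = inj₂ (there (there (there (here refl))))
kA⊎hub kbc = inj₂ (there (there (there (there (here refl)))))
kA⊎hub kca = inj₂ (there (there (there (there (there (here refl))))))
kA⊎hub kA  = inj₁ refl

module _ {m : ℕ} where

  rep : Kind → Fin (8+ m)
  rep kh  = 0F
  rep kb  = 1F
  rep kc  = 2F
  rep kab = 3F
  rep kbc = 4F
  rep kca = 5F
  rep kA  = 6F

  kind-rep : ∀ k → kind (rep k) ≡ k
  kind-rep kh  = refl
  kind-rep kb  = refl
  kind-rep kc  = refl
  kind-rep kab = refl
  kind-rep kbc = refl
  kind-rep kca = refl
  kind-rep kA  = refl

  -- Only the clique kind is shared by several vertices.
  kA⊎rep : ∀ (a : Fin (8+ m)) → kind a ≡ kA ⊎ a ≡ rep (kind a)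
  kA⊎rep 0F = inj₂ refl
  kA⊎rep 1F = inj₂ refl
  kA⊎rep 2F = inj₂ refl
  kA⊎rep 3F = inj₂ refl
  kA⊎rep 4F = inj₂ refl
  kA⊎rep 5F = inj₂ refl
  kA⊎rep (6+ a) = inj₁ refl

extAdj-≢ : ∀ {n} {a b : Fin n} → a ≢ b → extAdj a b ≡ adjK (kind a) (kind b)
extAdj-≢ {a = a} {b} a≢b with a ≟ b
... | yes a≡b = contradiction a≡b a≢b
... | no _    = refl

module _ {m} (G : Graph (8+ m)) where
  open Walks G

  -- The value of vertex at kA is irrelevant: kA is the kind of all free vertices.
  record Skeleton : Set where
    field
      vertex : Kind → Fin (8+ m)

    Free : Fin (8+ m) → Set
    Free a = All (a ≢_) (map vertex hubs)

    field
      distinct  : AllPairs (λ k l → vertex k ≢ vertex l) hubs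
      hub-hub   : AllPairs (λ k l → adj G (vertex k) (vertex l) ≡ adjK k l) hubs
      hub-free  : ∀ {a} → Free a → All (λ k → adj G (vertex k) a ≡ adjK k kA) hubs
      free-free : ∀ {a b} → Free a → Free b → a ≢ b → a ~ b

  -- A permutation carrying the six hub vertices to 0, ..., 5 leaves clique positions for the free
  -- vertices, and then adjacency of distinct vertices is determined by kinds on both sides.
  skeleton⇒≅ : Skeleton → G ≅ Extremal (8+ m)
  skeleton⇒≅ skeleton = π , same
    where
    open Skeleton skeleton

    reps : AllPairs (λ k l → rep {m} k ≢ rep l) hubs
    reps = from-yes (AllPairs.allPairs? (λ k l → ¬? (rep {m} k ≟ rep l)) hubs)

    π : Permutation′ (8+ m)
    π = proj₁ (∃permutation vertex rep distinct reps)

    π-vertex : ∀ {k} → k ∈ hubs → π ⟨$⟩ʳ vertex k ≡ rep k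
    π-vertex = All.lookup (proj₂ (∃permutation vertex rep distinct reps))

    data View (a : Fin (8+ m)) : Set where
      hub  : ∀ {k} → k ∈ hubs → a ≡ vertex k → View a
      free : Free a → View a

    view : ∀ a → View a
    view a with any? (a ≟_) (map vertex hubs)
    ... | no ¬any = free (¬Any⇒All¬ _ ¬any)
    ... | yes a∈  = let k , k∈ , e = ∈-map⁻ vertex a∈ in hub k∈ e

    kind-hub : ∀ {k} → k ∈ hubs → kind (π ⟨$⟩ʳ vertex k) ≡ k
    kind-hub k∈ = trans (cong kind (π-vertex k∈)) (kind-rep _)

    kind-free : ∀ {a} → Free a → kind (π ⟨$⟩ʳ a) ≡ kA
    kind-free {a} fr with kA⊎rep (π ⟨$⟩ʳ a)
    ... | inj₁ e = e
    ... | inj₂ e with kA⊎hub (kind (π ⟨$⟩ʳ a))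
    ... | inj₁ e′ = e′
    ... | inj₂ k∈ = contradiction
      (Injection.injective (↔⇒↣ π) (trans e (sym (π-vertex k∈)))) (All.lookup fr (∈-map⁺ vertex k∈))

    kinds : ∀ {a b} → a ≢ b → adj G a b ≡ adjK (kind (π ⟨$⟩ʳ a)) (kind (π ⟨$⟩ʳ b))
    kinds {a} {b} a≢b with view a | view b
    ... | free fa | free fb = trans (free-free fa fb a≢b) (sym (cong₂ adjK (kind-free fa) (kind-free fb)))
    ... | hub k∈ refl | free fb =
      trans (All.lookup (hub-free fb) k∈) (sym (cong₂ adjK (kind-hub k∈) (kind-free fb)))
    ... | free fa | hub {l} l∈ refl = trans (adj-sym G a b) (trans (All.lookup (hub-free fa) l∈)
      (trans (adjK-sym l kA) (sym (cong₂ adjK (kind-free fa) (kind-hub l∈)))))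
    ... | hub {k} k∈ refl | hub {l} l∈ refl = trans pair (sym (cong₂ adjK (kind-hub k∈) (kind-hub l∈)))
      where
      pair : adj G (vertex k) (vertex l) ≡ adjK k l
      pair with allPairs-lookup hub-hub k∈ l∈
      ... | inj₁ k≡l = contradiction (cong vertex k≡l) a≢b
      ... | inj₂ (inj₁ e) = e
      ... | inj₂ (inj₂ e) = trans (adj-sym G _ _) (trans e (adjK-sym l k))

    same : ∀ a b → adj G a b ≡ extAdj (π ⟨$⟩ʳ a) (π ⟨$⟩ʳ b)
    same a b with a ≟ b
    ... | yes refl = trans (irrefl G a) (sym (extAdj-irrefl (π ⟨$⟩ʳ a)))
    ... | no a≢b   = trans (kinds a≢b) (sym (extAdj-≢ (a≢b ∘ Injection.injective (↔⇒↣ π))))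

  open Full G

  -- From a frame to the whole graph

  module _ {z} (diameter : ∀ a b → Reach G 3 a b)
    (far : ∀ {a} → a ≢ z → ∃ λ b → ¬ Near a b) (centre : ∀ a → Near z a)
    (few : ∀ {xs} → Unique xs → All (¬_ ∘ Full) xs → length xs ≤ 5) where
    open DiameterThree diameter far centre

    -- The skeleton serves uniqueness; the five vertices that are not full serve the upper bound.
    frame⇒skeleton : ∀ {v u x y w w′} → Full v → Frame v u x y w w′ →
                     Skeleton × ∃ λ xs → 5 ≤ length xs × Unique xs × All (¬_ ∘ Full) xs
    frame⇒skeleton {v} {u} {x} {y} {w} {w′} full-v frame
      -- As n - 4 > 3, v has a neighbour besides z, w and w′, which supplies the eighth vertex for
      -- `Count`.
      with t , v~t , t≢z ∷ t≢w ∷ t≢w′ ∷ [] ← numWith-∃inside (z ∷ w ∷ w′ ∷ []) (degree-numWith v)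
             (subst (3 <_) (sym full-v) (s≤s (s≤s (s≤s (s≤s z≤n)))))
      = record
      { vertex = vertex
      ; distinct = AllPairsₚ.map⁻ (distinct-at (4F ∷ 2F ∷ 3F ∷ 5F ∷ 1F ∷ 6F ∷ []))
      ; hub-hub =
          (z~x ∷ z~y ∷ ≁ (w≁z ∘ ~-sym) ∷ ≁ (close≁u v≈z) ∷ ≁ (F′.w≁z ∘ ~-sym) ∷ []) ∷
          (≁ x≁y ∷ ~-sym w~x ∷ ~-sym u~x ∷ ≁ (F′.w-y-far ∘ near₁ ∘ ~-sym) ∷ []) ∷
          (≁ (w-y-far ∘ near₁ ∘ ~-sym) ∷ ~-sym u~y ∷ ~-sym w′~y ∷ []) ∷
          (≁ (close≁u v≈w) ∷ ≁ w≁w′ ∷ []) ∷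
          (≁ (u≁close v≈w′) ∷ []) ∷ [] ∷ []
      ; hub-free = λ { fr@(a≢z ∷ a≢x ∷ a≢y ∷ a≢w ∷ a≢u ∷ a≢w′ ∷ []) →
          ~-sym (free~ fr (a≢z ∘ sym) (vs≢ 4F 1F) (vs≢ 4F 2F) (vs≢ 4F 3F))
          ∷ ≁ (free≁x fr ∘ ~-sym) ∷ ≁ (free≁y fr ∘ ~-sym)
          ∷ ~-sym (free~ fr (a≢w ∘ sym) (vs≢ 5F 1F) (vs≢ 5F 2F) (vs≢ 5F 3F))
          ∷ ≁ (u≁close (others _ a≢u a≢x a≢y))
          ∷ ~-sym (free~ fr (a≢w′ ∘ sym) (vs≢ 6F 1F) (vs≢ 6F 2F) (vs≢ 6F 3F)) ∷ [] }
      ; free-free = λ { fa (_ ∷ b≢x ∷ b≢y ∷ _ ∷ b≢u ∷ _ ∷ []) a≢b → free~ fa (a≢b ∘ sym) b≢u b≢x b≢y }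
      } , outcasts , ℕ.≤-refl , outcasts-unique , outcasts-¬full
      where
      open Frames frame
      module F′ = Frames (frame-swap frame)

      t≢v : t ≢ v
      t≢v refl = ~-irrefl v~t

      module C = Count frame (inj₂ v~t) t≢v t≢z t≢w t≢w′
      open C using (distinct-at)

      ≁ : ∀ {a b} → ¬ a ~ b → adj G a b ≡ _
      ≁ = Bool.¬-not

      vertex : Kind → Fin (8+ m)
      vertex kh  = z
      vertex kb  = x
      vertex kc  = y
      vertex kab = w
      vertex kbc = u
      vertex kca = w′
      vertex kA  = v

      vs≢ : ∀ i j {_ : True (¬? (i ≟ j))} → lookup C.vertices i ≢ lookup C.vertices j
      vs≢ i j {i≢j} = toWitness i≢j ∘ Vec.lookup-injective C.distinct i j

      -- For a = v this is part of the corner; every other free vertex can take the place of t in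
      -- `Count`.
      free≁x : ∀ {a} → All (a ≢_) (z ∷ x ∷ y ∷ w ∷ u ∷ w′ ∷ []) → ¬ a ~ x
      free≁x {a} (a≢z ∷ a≢x ∷ a≢y ∷ a≢w ∷ a≢u ∷ a≢w′ ∷ []) with a ≟ v
      ... | yes refl = v≁x
      ... | no a≢v   = Count.t≁x frame (others a a≢u a≢x a≢y) a≢v a≢z a≢w a≢w′ few

      free≁y : ∀ {a} → All (a ≢_) (z ∷ x ∷ y ∷ w ∷ u ∷ w′ ∷ []) → ¬ a ~ y
      free≁y {a} (a≢z ∷ a≢x ∷ a≢y ∷ a≢w ∷ a≢u ∷ a≢w′ ∷ []) with a ≟ v
      ... | yes refl = v≁y
      ... | no a≢v   = Count.t≁x (frame-swap frame) (others a a≢u a≢x a≢y) a≢v a≢z a≢w′ a≢w few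

      t≢hubs : All (t ≢_) (z ∷ x ∷ y ∷ w ∷ u ∷ w′ ∷ [])
      t≢hubs = vs≢ 7F 4F ∷ vs≢ 7F 2F ∷ vs≢ 7F 3F ∷ vs≢ 7F 5F ∷ vs≢ 7F 1F ∷ vs≢ 7F 6F ∷ []

      outcasts : List (Fin (8+ m))
      outcasts = u ∷ w ∷ w′ ∷ x ∷ y ∷ []

      outcasts-unique : Unique outcasts
      outcasts-unique = distinct-at (1F ∷ 5F ∷ 6F ∷ 2F ∷ 3F ∷ [])

      outcasts-¬full : All (¬_ ∘ Full) outcasts
      outcasts-¬full = C.¬full-u ∷ C.¬full-w ∷ C.¬full-w′ ∷ C.¬full-x (free≁x t≢hubs)
        ∷ C.¬full-y (free≁y t≢hubs) ∷ []

      -- A further vertex that is not full would be the sixth.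
      full-others : ∀ {a} → All (a ≢_) outcasts → Full a
      full-others {a} a≢ = decidable-stable (full? a) λ ¬fa →
        ℕ.<-irrefl refl (few (a≢ ∷ outcasts-unique) (¬fa ∷ outcasts-¬full))

      -- The free vertex a is full and already misses a, u, x and y, so b cannot be a fifth
      -- non-neighbour.
      free~ : ∀ {a b} → All (a ≢_) (z ∷ x ∷ y ∷ w ∷ u ∷ w′ ∷ []) → b ≢ a → b ≢ u → b ≢ x → b ≢ y → a ~ b
      free~ {a} {b} fr@(a≢z ∷ a≢x ∷ a≢y ∷ a≢w ∷ a≢u ∷ a≢w′ ∷ []) b≢a b≢u b≢x b≢y =
        decidable-stable (a ~? b) λ a≁b → ¬full ℕ.≤-refl
          ((b≢a ∷ b≢u ∷ b≢x ∷ b≢y ∷ []) ∷ (a≢u ∷ a≢x ∷ a≢y ∷ []) ∷ distinct-at (1F ∷ 2F ∷ 3F ∷ []))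
          (a≁b ∷ ~-irrefl ∷ close≁u (others a a≢u a≢x a≢y) ∷ free≁x fr ∷ free≁y fr ∷ [])
          (full-others (a≢u ∷ a≢w ∷ a≢w′ ∷ a≢x ∷ a≢y ∷ []))

-- The extremal graph

-- Kinds are compared through their representatives, as `kind` is a left inverse of `rep`.
_≟ᴷ_ : (k l : Kind) → Dec (k ≡ l)
k ≟ᴷ l = map′ (λ e → trans (sym (kind-rep {0} k)) (trans (cong kind e) (kind-rep l)))
  (cong rep) (rep {0} k ≟ rep l)

∈kinds : ∀ k → k ∈ kA ∷ hubs
∈kinds k = [ here , there ]′ (kA⊎hub k)

-- There are only seven kinds, so the distance facts below are settled by evaluation.
∀kind? : ∀ {P : Kind → Set} → Decidable P → Dec (∀ k → P k)
∀kind? P? = map′ (λ all k → All.lookup all (∈kinds k)) (λ f → All.universal f _)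
  (All.all? P? (kA ∷ hubs))

∃kind? : ∀ {P : Kind → Set} → Decidable P → Dec (∃ P)
∃kind? P? = map′ satisfied (λ (k , Pk) → lose (∈kinds k) Pk) (any? P? (kA ∷ hubs))

Step : Kind → Kind → Set
Step k l = k ≡ l ⊎ adjK k l ≡ true

step? : ∀ k l → Dec (Step k l)
step? k l = k ≟ᴷ l ⊎-dec adjK k l Bool.≟ true

Steps₂ Steps₃ : Kind → Kind → Set
Steps₂ k l = ∃ λ c → Step k c × Step c l
Steps₃ k l = ∃ λ c → Step k c × Steps₂ c l

steps₂? : ∀ k l → Dec (Steps₂ k l)
steps₂? k l = ∃kind? λ c → step? k c ×-dec step? c l

steps₃? : ∀ k l → Dec (Steps₃ k l)
steps₃? k l = ∃kind? λ c → step? k c ×-dec steps₂? c l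

steps₃ : ∀ k l → Steps₃ k l
steps₃ = from-yes (∀kind? λ k → ∀kind? λ l → steps₃? k l)

steps₂-kh : ∀ l → Steps₂ kh l
steps₂-kh = from-yes (∀kind? λ l → steps₂? kh l)

-- A kind at distance three, witnessing eccentricity three; `kh` has none and is sent to itself.
antipode : Kind → Kind
antipode kh  = kh
antipode kb  = kca
antipode kc  = kab
antipode kab = kc
antipode kbc = kA
antipode kca = kb
antipode kA  = kbc

antipode-remote : ∀ k → k ≢ kh → ¬ Steps₂ k (antipode k)
antipode-remote = from-yes (∀kind? λ k → ¬? (k ≟ᴷ kh) →-dec ¬? (steps₂? k (antipode k)))

module _ (m : ℕ) where
  private
    E : Graph (8+ m)
    E = Extremal (8+ m)

  open Walks E
  open Full E

  -- Standing still on kinds can still mean moving between vertices: distinct vertices of equal kind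
  -- lie in the clique, hence are adjacent.
  step-reach : ∀ j {a b c} → Step (kind b) (kind c) → Reach E j a b → Reach E (suc j) a c
  step-reach j {a} {b} {c} step r with b ≟ c
  ... | yes refl = inj₁ r
  ... | no b≢c with step | kA⊎rep b | kA⊎rep c
  ... | inj₂ e | _ | _ = inj₂ (b , r , trans (extAdj-≢ b≢c) e)
  ... | inj₁ e | inj₁ bA | _ = inj₂ (b , r , trans (extAdj-≢ b≢c) (cong₂ adjK bA (trans (sym e) bA)))
  ... | inj₁ e | _ | inj₁ cA = inj₂ (b , r , trans (extAdj-≢ b≢c) (cong₂ adjK (trans e cA) cA))
  ... | inj₁ e | inj₂ b≡ | inj₂ c≡ = contradiction (trans b≡ (trans (cong rep e) (sym c≡))) b≢c

  to-rep : ∀ {k c} → Step k c → Step k (kind (rep {m} c))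
  to-rep {k} {c} = subst (Step k) (sym (kind-rep c))

  from-rep : ∀ {c l} → Step c l → Step (kind (rep {m} c)) l
  from-rep {c} {l} = subst (λ d → Step d l) (sym (kind-rep c))

  steps₂-reach : ∀ j {a b c} → Steps₂ (kind b) (kind c) → Reach E j a b → Reach E (2 + j) a c
  steps₂-reach j (_ , s , t) r = step-reach (suc j) (from-rep t) (step-reach j (to-rep s) r)

  reach₃ : ∀ a b → Reach E 3 a b
  reach₃ a b with c , s , d , t , u ← steps₃ (kind a) (kind b)
    = steps₂-reach 1 (d , from-rep t , u) (step-reach 0 (to-rep s) refl)

  ~⇒adjK : ∀ {a b} → a ~ b → adjK (kind a) (kind b) ≡ true
  ~⇒adjK {a} {b} a~b with a ≟ b
  ... | no _ = a~b

  near⇒steps₂ : ∀ {a b} → Near a b → Steps₂ (kind a) (kind b)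
  near⇒steps₂ near with near-view near
  ... | inj₁ refl = _ , inj₁ refl , inj₁ refl
  ... | inj₂ (inj₁ a~b) = _ , inj₁ refl , inj₂ (~⇒adjK a~b)
  ... | inj₂ (inj₂ (c , a~c , c~b)) = kind c , inj₂ (~⇒adjK a~c) , inj₂ (~⇒adjK c~b)

  isEcc₃ : ∀ {a} → a ≢ 0F → IsEcc E a 3
  isEcc₃ {a} a≢0 = (λ b k d → proj₂ d 3 (reach₃ a b)) , rep (antipode (kind a)) ,
    ¬reach⇒isDist (λ near → antipode-remote (kind a) kind≢
      (subst (Steps₂ (kind a)) (kind-rep (antipode (kind a))) (near⇒steps₂ near))) (reach₃ a _)
    where
    kind≢ : kind a ≢ kh
    kind≢ e with kA⊎rep a
    ... | inj₁ e′ with () ← trans (sym e) e′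
    ... | inj₂ e′ = a≢0 (trans e′ (cong rep e))

  isDiam₃ : IsDiam E 3
  isDiam₃ = (λ a e (_ , b , d) → proj₂ d 3 (reach₃ a b)) , 1F , isEcc₃ λ ()

  ¬peripheral-0 : ¬ Peripheral E 0F
  ¬peripheral-0 (D , isDiam , _ , b , d) with refl ← isDiam-unique isDiam isDiam₃ =
    ℕ.<⇒≱ ℕ.≤-refl (proj₂ d 2 (steps₂-reach 0 {b = 0F} (steps₂-kh (kind b)) refl))

  extremal-almostPeripheral : AlmostPeripheral E
  extremal-almostPeripheral = (λ a b → 3 , reach₃ a b) ,
    numWith-outsiders ([] ∷ []) (¬peripheral-0 ∷ []) λ
      { zero → inj₂ (here refl) ; (suc a) → inj₁ (3 , isDiam₃ , isEcc₃ λ ()) }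

  degree≡ : ∀ a {xs} → Unique xs → All (λ b → ¬ a ~ b) xs → (∀ b → a ~ b ⊎ b ∈ xs) →
            degree E a ≡ 8+ m ∸ length xs
  degree≡ a uxs ≁xs cover = numWith-unique (degree-numWith a) (numWith-outsiders uxs ≁xs cover)

  full-0 : Full 0F
  full-0 = degree≡ 0F (from-yes (unique? _≟_ (0F ∷ 3F ∷ 4F ∷ 5F ∷ [])))
    ((λ ()) ∷ (λ ()) ∷ (λ ()) ∷ (λ ()) ∷ []) λ
    { 0F → inj₂ (here refl)
    ; 1F → inj₁ refl
    ; 2F → inj₁ refl
    ; 3F → inj₂ (there (here refl))
    ; 4F → inj₂ (there (there (here refl)))
    ; 5F → inj₂ (there (there (there (here refl))))
    ; (6+ b) → inj₁ refl }

  full-A : ∀ a → Full (6+ a)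
  full-A a = degree≡ (6+ a)
    (((λ ()) ∷ (λ ()) ∷ (λ ()) ∷ []) ∷ from-yes (unique? _≟_ (1F ∷ 2F ∷ 4F ∷ [])))
    (~-irrefl {6+ a} ∷ (λ ()) ∷ (λ ()) ∷ (λ ()) ∷ []) cover
    where
    cover : ∀ b → 6+ a ~ b ⊎
                  b ∈ 6+ a ∷ 1F ∷ 2F ∷ 4F ∷ []
    cover 0F = inj₁ refl
    cover 1F = inj₂ (there (here refl))
    cover 2F = inj₂ (there (there (here refl)))
    cover 3F = inj₁ refl
    cover 4F = inj₂ (there (there (there (here refl))))
    cover 5F = inj₁ refl
    cover (6+ b) with a ≟ b
    ... | yes refl = inj₂ (here refl)
    ... | no _     = inj₁ refl

  -- Five non-neighbours, the vertex itself included, push each degree below n - 4. For b and c two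
  -- clique vertices are among them, available because n ≥ 8.
  sparse : All (λ a → degree E a < 4+ m) (1F ∷ 2F ∷ 3F ∷ 4F ∷ 5F ∷ [])
  sparse =
    degree< 1F (1F ∷ 2F ∷ 5F ∷ 6F ∷ 7F ∷ []) ∷
    degree< 2F (1F ∷ 2F ∷ 3F ∷ 6F ∷ 7F ∷ []) ∷
    degree< 3F (0F ∷ 2F ∷ 3F ∷ 4F ∷ 5F ∷ []) ∷
    degree< 4F (0F ∷ 3F ∷ 4F ∷ 5F ∷ 6F ∷ []) ∷
    degree< 5F (0F ∷ 1F ∷ 3F ∷ 4F ∷ 5F ∷ []) ∷ []
    where
    degree< : ∀ a xs {_ : True (unique? _≟_ xs)}
              {_ : True (All.all? (λ b → ¬? (a ~? b)) xs)}
              {_ : True (5 ℕ.≤? length xs)} → degree E a < 4+ m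
    degree< a xs {uxs} {≁xs} {5≤} = ℕ.+-cancelˡ-≤ 4 _ _ (ℕ.≤-trans (ℕ.+-monoˡ-≤ (degree E a) (toWitness 5≤))
      (numWith-outside-≤ (degree-numWith a) (toWitness uxs) (toWitness ≁xs)))

  full⊎sparse : ∀ a → Full a ⊎ a ∈ 1F ∷ 2F ∷ 3F ∷ 4F ∷ 5F ∷ []
  full⊎sparse 0F = inj₁ full-0
  full⊎sparse 1F = inj₂ (here refl)
  full⊎sparse 2F = inj₂ (there (here refl))
  full⊎sparse 3F = inj₂ (there (there (here refl)))
  full⊎sparse 4F = inj₂ (there (there (there (here refl))))
  full⊎sparse 5F = inj₂ (there (there (there (there (here refl)))))
  full⊎sparse (6+ a) = inj₁ (full-A a)

  extremal-maxDegree : MaxDegree E (4+ m)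
  extremal-maxDegree =
    (λ a → [ ℕ.≤-reflexive , ℕ.<⇒≤ ∘ All.lookup sparse ]′ (full⊎sparse a)) , 0F , full-0

  extremal-full : NumWith Full (3 + m)
  extremal-full = numWith-outsiders (from-yes (unique? _≟_ (1F ∷ 2F ∷ 3F ∷ 4F ∷ 5F ∷ [])))
    (All.map ℕ.<⇒≢ sparse) full⊎sparse

-- Upper bound and uniqueness

module _ {m} (G : Graph (8+ m)) where
  open Walks G
  open Full G

  -- Assuming only k ≥ n - 5 lets one argument serve both claims: `few` then allows at most five
  -- vertices that are not full.
  structure : ∀ {k} → AlmostPeripheral G → MaxDegree G (4+ m) → NumWith Full k → 3 + m ≤ k →
              Skeleton G × ∃ λ xs → 5 ≤ length xs × Unique xs × All (¬_ ∘ Full) xs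
  structure {k} ap@(connected , _) (≤Δ , _) num 3+m≤k
    with z , e , centred ← almostPeripheral⇒centred (s≤s (s≤s (s≤s z≤n))) ap
    -- Since z has at most n - 4 neighbours, some other vertex is not adjacent to it; this excludes
    -- eccentricities 0 and 1 for z.
    with u₀ , z≁u₀ , u₀≢z ∷ [] ← numWith-∃outside (z ∷ []) (degree-numWith z)
           (ℕ.≤-trans (s≤s (s≤s (≤Δ z))) (ℕ.+-monoˡ-≤ m {6} {8} (s≤s (s≤s (s≤s (s≤s (s≤s (s≤s z≤n))))))))
    with v , full-v , v≢z ∷ [] ← numWith-∃inside (z ∷ []) num (ℕ.≤-trans (s≤s (s≤s z≤n)) 3+m≤k)
    = by-eccentricity e centred
    where
    few : ∀ {xs} → Unique xs → All (¬_ ∘ Full) xs → length xs ≤ 5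
    few {xs} uxs ¬fs = ℕ.+-cancelʳ-≤ (3 + m) (length xs) 5
      (ℕ.≤-trans (ℕ.+-monoʳ-≤ (length xs) 3+m≤k) (numWith-outside-≤ num uxs ¬fs))

    by-eccentricity : ∀ e → Centred z e →
      Skeleton G × ∃ λ xs → 5 ≤ length xs × Unique xs × All (¬_ ∘ Full) xs
    by-eccentricity 0 c = contradiction (sym (Centred.centre c u₀)) u₀≢z
    by-eccentricity 1 c with Centred.centre c u₀
    ... | inj₁ z≡u₀ = contradiction (sym z≡u₀) u₀≢z
    ... | inj₂ (_ , refl , z~u₀) = contradiction z~u₀ z≁u₀
    by-eccentricity 2 c
      with u , remote ← Centred.far c v≢z
      with x , y , corner ← full-corner connected full-v remote
      with w , w′ , frame ← DiameterThree.corner⇒frame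
             (Centred.diameter c) (Centred.far c) (Centred.centre c) v≢z corner
      = frame⇒skeleton G (Centred.diameter c) (Centred.far c) (Centred.centre c) few full-v frame
    -- Here the diameter is at least four, and `near-corner` brings u within three steps of v,
    -- closer than it was chosen.
    by-eccentricity (suc (suc (suc e))) c
      with u , remote ← Centred.far c v≢z
      with x , y , corner ← full-corner connected full-v (remote ∘ reach-mono (s≤s (s≤s z≤n)))
      = contradiction (reach-mono 3≤ (near-corner connected
          (λ a≢z → let b , ¬r = Centred.far c a≢z in b , ¬r ∘ reach-mono 3≤) corner)) remote
      where
      3≤ : 3 ≤ 3 + e
      3≤ = s≤s (s≤s (s≤s z≤n))

theorem11 : ∀ n → 8 ≤ n →
    ((G : Graph n) → AlmostPeripheral G → MaxDegree G (n ∸ 4) →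
    ∀ k → NumWith (λ v → degree G v ≡ n ∸ 4) k → k ≤ n ∸ 5)
    × (AlmostPeripheral (Extremal n) × MaxDegree (Extremal n) (n ∸ 4)
    × NumWith (λ v → degree (Extremal n) v ≡ n ∸ 4) (n ∸ 5))
    × ((G : Graph n) → AlmostPeripheral G → MaxDegree G (n ∸ 4) →
    NumWith (λ v → degree G v ≡ n ∸ 4) (n ∸ 5) → G ≅ Extremal n)
theorem11 (8+ m) (s≤s (s≤s (s≤s (s≤s (s≤s (s≤s (s≤s (s≤s _)))))))) =
  bound ,
  (extremal-almostPeripheral m , extremal-maxDegree m , extremal-full m) ,
  λ G ap Δ num → skeleton⇒≅ G (proj₁ (structure G ap Δ num ℕ.≤-refl))
  where
  bound : (G : Graph (8+ m)) → AlmostPeripheral G → MaxDegree G (4+ m) →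
          ∀ k → NumWith (λ v → degree G v ≡ 4+ m) k → k ≤ 3 + m
  bound G ap Δ k num with ℕ.≤-total k (3 + m)
  ... | inj₁ k≤ = k≤
  -- If k ≥ n - 5, five vertices are not full, so k ≤ n - 5 after all.
  ... | inj₂ ≤k with _ , xs , 5≤ , uxs , ¬fs ← structure G ap Δ num ≤k =
    ℕ.+-cancelˡ-≤ 5 k (3 + m) (ℕ.≤-trans (ℕ.+-monoˡ-≤ k 5≤) (numWith-outside-≤ num uxs ¬fs))
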